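{- Let $m \ge 1$, let $\Sigma_1,\dots,\Sigma_m$ and $\Delta_1,\dots,\Delta_m$ be (possibly infinite) sets, and let $P \subseteq \Sigma_1 \times \cdots \times \Sigma_m$, $Q \subseteq \Delta_1 \times \cdots \times \Delta_m$, and $\Phi \subseteq \Delta_1^{\Sigma_1} \times \cdots \times \Delta_m^{\Sigma_m}$. Suppose that $|\Sigma_i| \ge 2$ for all $i$, and that $P$ has full projections, i.e. $P|_i = \Sigma_i$ for all $i$. Then the relation pair $(P,Q)$ is $\Phi$-box-trivial for all $n \ge 1$ if and only if it is $\Phi$-box-trivial for $n=2$.
   Context: Here $[n] = \{1,\dots,n\}$, $\Delta^{\Sigma}$ is the set of all functions $\Sigma \to \Delta$, $\operatorname{im} f$ is the image of $f$, and $P|_i = \{x_i : x \in P\}$. Let $P \subseteq \Sigma_1 \times \cdots \times \Sigma_m$ and $Q \subseteq \Delta_1 \times \cdots \times \Delta_m$. An $n$-ary polymorphism of $(P,Q)$ is an $m$-tuple of functions $(f_1,\dots,f_m)$, where $f_i\colon \Sigma_i^n \to \Delta_i$, such that whenever $x^{(1)},\dots,x^{(n)} \in P$, we have $(f_1(x^{(1)}_1,\dots,x^{(n)}_1), \dots, f_m(x^{(1)}_m,\dots,x^{(n)}_m)) \in Q$. Let $\Phi \subseteq \Delta_1^{\Sigma_1} \times \cdots \times \Delta_m^{\Sigma_m}$. An $m$-tuple of functions $(f_1,\dots,f_m)$, where $f_i\colon \Sigma_i^n \to \Delta_i$, is $\Phi$-box-trivial if at least one of the following holds: (Dictator type) there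 exist $s \in [n]$ and $(\phi_1,\dots,\phi_m) \in \Phi$ such that $f_i(x) = \phi_i(x_s)$ for all $i \in [m]$ and all $x \in \Sigma_i^n$; (Box type) $\operatorname{im} f_1 \times \cdots \times \operatorname{im} f_m \subseteq Q$. The relation pair $(P,Q)$ is $\Phi$-box-trivial for $n$, where $n \ge 1$, if every $n$-ary polymorphism of $(P,Q)$ is $\Phi$-box-trivial. -}

module Defs where

open import Data.Fin.Base using (Fin)
open import Data.Nat.Base using (ℕ)
open import Data.Product.Base using (∃; ∃₂; ∃-syntax; _×_)
open import Data.Sum.Base using (_⊎_)
open import Data.Vec.Functional using (Vector)
open import Level using (Level)
open import Relation.Binary.PropositionalEquality.Core using (_≡_; _≢_)
open import Relation.Unary using (Pred; _∈_; _⊆_; Universal)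

private
  variable
    ℓ : Level
    m n : ℕ

Family : ℕ → (ℓ : Level) → Set (Level.suc ℓ)
Family m ℓ = Fin m → Set ℓ

-- Tuples that agree in every coordinate are propositionally equal only under
-- function extensionality out of Fin m; predicates on tuples represent subsets
-- of the product under that assumption.
Tuple : Family m ℓ → Set ℓ
Tuple A = ∀ i → A i

Relation : Family m ℓ → Set (Level.suc ℓ)
Relation {ℓ = ℓ} A = Pred (Tuple A) ℓ

Maps : Family m ℓ → Family m ℓ → Set ℓ
Maps Σ Δ = Tuple (λ i → Σ i → Δ i)

Operations : ℕ → Family m ℓ → Family m ℓ → Set ℓ
Operations n Σ Δ = Tuple (λ i → Vector (Σ i) n → Δ i)

Im : {A B : Set ℓ} → (A → B) → Pred B ℓ
Im f y = ∃[ x ] f x ≡ y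

Box : {A : Family m ℓ} → (∀ i → Pred (A i) ℓ) → Relation A
Box X y = ∀ i → y i ∈ X i

_∣_ : {A : Family m ℓ} → Relation A → ∀ i → Pred (A i) ℓ
(P ∣ i) a = ∃[ x ] x ∈ P × x i ≡ a

FullProjections : {A : Family m ℓ} → Relation A → Set ℓ
FullProjections P = ∀ i → Universal (P ∣ i)

AtLeastTwo : Set ℓ → Set ℓ
AtLeastTwo A = ∃₂ λ (a b : A) → a ≢ b

module _ {Σ Δ : Family m ℓ} where

  -- x s i is the i-th coordinate of the s-th tuple, so the i-th operation is
  -- applied to the column λ s → x s i.
  IsPolymorphism : Relation Σ → Relation Δ → Operations n Σ Δ → Set ℓ
  IsPolymorphism {n = n} P Q f =
    (x : Vector (Tuple Σ) n) → (∀ s → x s ∈ P) →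
    (λ i → f i (λ s → x s i)) ∈ Q

  DictatorType : Pred (Maps Σ Δ) ℓ → Operations n Σ Δ → Set ℓ
  DictatorType Φ f = ∃₂ λ s φ → φ ∈ Φ × (∀ i x → f i x ≡ φ i (x s))

  BoxType : Relation Δ → Operations n Σ Δ → Set ℓ
  BoxType Q f = Box (λ i → Im (f i)) ⊆ Q

  BoxTrivialOperations : Relation Δ → Pred (Maps Σ Δ) ℓ → Operations n Σ Δ → Set ℓ
  BoxTrivialOperations Q Φ f = DictatorType Φ f ⊎ BoxType Q f

  BoxTrivial : Relation Σ → Relation Δ → Pred (Maps Σ Δ) ℓ → ℕ → Set ℓ
  BoxTrivial P Q Φ n =
    (f : Operations n Σ Δ) → IsPolymorphism P Q f → BoxTrivialOperations Q Φ f

{-# OPTIONS --safe #-}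
-- Induct on the arity, fixing the first argument of f to a tuple p ∈ P.
--
-- If some such section is not of box type, it is a dictator φ at a position t, and
-- φ is not of box type either. The binary minors of f obtained by merging arguments
-- contain φ in their images, hence are dictators; comparing them shows that every
-- other section is the dictator φ at the same position t, so f is a dictator.
--
-- If all sections are of box type, any g with g_i(a , c) in the image of
-- f_i(a , _) is a binary polymorphism. When f is not of box type, g can be chosen
-- to hit a tuple outside Q, and to depend on c as soon as f depends on anything but
-- its first argument. As g must be a dictator, f depends on its first argument only.
module Submission where

open import Axiom.ExcludedMiddle using (ExcludedMiddle)
open import Axiom.Extensionality.Propositional using (Extensionality)
open import Data.Bool.Base using (if_then_else_)
open import Data.Empty using (⊥-elim)
open import Data.Fin.Base using (Fin; zero; suc; fromℕ<)
open import Data.Fin.Properties using (suc-injective) renaming (_≟_ to _≟ᶠ_)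
open import Data.Nat.Base using (ℕ; zero; suc; _≥_; s≤s; z≤n)
open import Data.Product.Base using (∃-syntax; _×_; _,_; proj₁; proj₂)
open import Data.Sum.Base using (inj₁; inj₂)
open import Data.Vec.Functional using (Vector; []; _∷_; head; tail)
open import Function.Base using (_∘_; const)
open import Function.Bundles using (_⇔_; mk⇔)
open import Level using (Level; 0ℓ)
open import Relation.Binary.PropositionalEquality
  using (_≡_; _≢_; refl; sym; trans; cong; subst)
open import Relation.Nullary using (¬_; yes; no; does; contradiction)
open import Relation.Nullary.Decidable using (decidable-stable; dec-true; dec-false)
open import Relation.Unary using (Pred; _∈_; _∉_; _⊆_)
open import Defs

private
  variable
    ℓ : Level
    m n k : ℕ

minor : {Σ Δ : Family m ℓ} → (Fin n → Fin k) → Operations n Σ Δ → Operations k Σ Δ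
minor π f i x = f i (x ∘ π)

section : {Σ Δ : Family m ℓ} → Operations (suc n) Σ Δ → Tuple Σ → Operations n Σ Δ
section f p i x = f i (p i ∷ x)

headMerge : Fin (suc n) → Fin 2
headMerge zero    = zero
headMerge (suc _) = suc zero

-- Isolates the position `t`: in the corresponding minor, all other arguments share one value.
singletonMerge : Fin n → Fin n → Fin 2
singletonMerge t s = if does (s ≟ᶠ t) then zero else suc zero

singletonMerge-≡ : (t : Fin n) → singletonMerge t t ≡ zero
singletonMerge-≡ t rewrite dec-true (t ≟ᶠ t) refl = refl

singletonMerge-≢ : {s t : Fin n} → s ≢ t → singletonMerge t s ≡ suc zero
singletonMerge-≢ {s = s} {t} s≢t rewrite dec-false (s ≟ᶠ t) s≢t = refl

pair : {A : Set ℓ} → A → A → Vector A 2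
pair a b = a ∷ b ∷ []

module _ (em : ExcludedMiddle ℓ) (ext : Extensionality 0ℓ ℓ)
         {Σ Δ : Family m ℓ} {P : Relation Σ} {Q : Relation Δ} {Φ : Pred (Maps Σ Δ) ℓ}
         where

  Q-respects : {a b : Tuple Δ} → (∀ i → a i ≡ b i) → a ∈ Q → b ∈ Q
  Q-respects a≗b = subst Q (ext a≗b)

  ∷-η : {A B : Set ℓ} (h : Vector A (suc n) → B) (x : Vector A (suc n)) →
        h (head x ∷ tail x) ≡ h x
  ∷-η h x = cong h (ext λ { zero → refl ; (suc _) → refl })

  minor-isPolymorphism : (π : Fin n → Fin k) (f : Operations n Σ Δ) →
                         IsPolymorphism P Q f → IsPolymorphism P Q (minor π f)
  minor-isPolymorphism π f f-poly x x∈P = f-poly (x ∘ π) (x∈P ∘ π)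

  section-isPolymorphism : (f : Operations (suc n) Σ Δ) → IsPolymorphism P Q f →
                           ∀ {p} → p ∈ P → IsPolymorphism P Q (section f p)
  section-isPolymorphism f f-poly {p} p∈P x x∈P =
    Q-respects
      (λ i → cong (f i) (ext λ { zero → refl ; (suc _) → refl }))
      (f-poly (p ∷ x) λ { zero → p∈P ; (suc s) → x∈P s })

  BoxMap : Pred (Maps Σ Δ) ℓ
  BoxMap φ = Box (λ i → Im (φ i)) ⊆ Q

  Im⊆⇒boxMap : {f : Operations n Σ Δ} {φ : Maps Σ Δ} →
               (∀ i a → Im (f i) (φ i a)) → BoxType Q f → BoxMap φ
  Im⊆⇒boxMap φ⊆f box y∈ = box λ i →
    let a , φa≡y = y∈ i ; x , fx≡φa = φ⊆f i a in x , trans fx≡φa φa≡y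

  -- The box of the images contains no tuple other than `q`, which is in `Q`.
  constant⇒boxMap : {φ : Maps Σ Δ} {q : Tuple Δ} → q ∈ Q →
                    (∀ i a → φ i a ≡ q i) → BoxMap φ
  constant⇒boxMap q∈Q φ≡q y∈ =
    Q-respects (λ i → let a , φa≡y = y∈ i in trans (sym (φ≡q i a)) φa≡y) q∈Q

  dictator-boxType : {f : Operations n Σ Δ} {φ : Maps Σ Δ} {s : Fin n} →
                     (∀ i x → f i x ≡ φ i (x s)) → BoxMap φ → BoxType Q f
  dictator-boxType {s = s} f≡φ box y∈ = box λ i →
    let x , fx≡y = y∈ i in x s , trans (sym (f≡φ i x)) fx≡y

  -- A dummy second argument turns `f` into a binary operation. Evaluating it at constant pairs
  -- makes the position `s` immaterial.
  boxTrivial₂⇒₁ : BoxTrivial P Q Φ 2 → BoxTrivial P Q Φ 1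
  boxTrivial₂⇒₁ triv₂ f f-poly
    with triv₂ (minor (const zero) f) (minor-isPolymorphism (const zero) f f-poly)
  ... | inj₁ (s , φ , φ∈Φ , f≡φ) = inj₁ (zero , φ , φ∈Φ , λ i x →
          trans (cong (f i) (ext λ { zero → refl })) (f≡φ i (const (x zero))))
  ... | inj₂ box = inj₂ λ y∈ → box λ i →
          let x , fx≡y = y∈ i in
          const (x zero) , trans (cong (f i) (ext λ { zero → refl })) fx≡y

  boxSections⇒dictator :
    BoxTrivial P Q Φ 2 → (∀ i → AtLeastTwo (Σ i)) → ∀ {p} → p ∈ P →
    (f : Operations (suc n) Σ Δ) → (∀ {q} → q ∈ P → BoxType Q (section f q)) →
    ∀ {b} → b ∈ Box (λ i → Im (f i)) → b ∉ Q → DictatorType Φ f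
  boxSections⇒dictator {n = n} triv₂ two {p} p∈P f box {b} b∈ b∉Q =
    conclude (triv₂ g g-poly)
    where
    c d a₀ : Tuple Σ
    c i = proj₁ (two i)
    d i = proj₁ (proj₂ (two i))
    a₀ i = head (proj₁ (b∈ i))

    -- A tail that reproduces `b i` when `a` is `a₀ i`. For other `a` the tail `const a` is an
    -- arbitrary default.
    U : ∀ i a → ∃[ x ] (a ≡ a₀ i → f i (a ∷ x) ≡ b i)
    U i a with em {a ≡ a₀ i}
    ... | yes refl = tail (proj₁ (b∈ i)) , λ _ → trans (∷-η (f i) _) (proj₂ (b∈ i))
    ... | no a≢a₀  = const a , λ a≡a₀ → contradiction a≡a₀ a≢a₀

    u : Maps Σ Δ
    u i a = f i (a ∷ proj₁ (U i a))

    u-a₀ : ∀ i → u i (a₀ i) ≡ b i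
    u-a₀ i = proj₂ (U i (a₀ i)) refl

    -- A tail with value different from `u i a` whenever one exists. If even this tail yields
    -- `u i a`, then `f i` ignores its tail at `a`.
    V : ∀ i a → ∃[ x ] (f i (a ∷ x) ≡ u i a → ∀ y → f i (a ∷ y) ≡ u i a)
    V i a with em {∃[ x ] f i (a ∷ x) ≢ u i a}
    ... | yes (x , fx≢u) = x , λ fx≡u → contradiction fx≡u fx≢u
    ... | no ∄x          = proj₁ (U i a) , λ _ y → decidable-stable em λ fy≢u → ∄x (y , fy≢u)

    v : Maps Σ Δ
    v i a = f i (a ∷ proj₁ (V i a))

    -- The second argument is a switch: `c i` selects `U`, anything else, in particular `d i`,
    -- selects `V`.
    G : ∀ i (w : Vector (Σ i) 2) → Vector (Σ i) n
    G i w = if does (em {w (suc zero) ≡ c i})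
              then proj₁ (U i (w zero)) else proj₁ (V i (w zero))

    g : Operations 2 Σ Δ
    g i w = f i (w zero ∷ G i w)

    g-c : ∀ i a → g i (pair a (c i)) ≡ u i a
    g-c i a = cong (λ t → f i (a ∷ (if t then proj₁ (U i a) else proj₁ (V i a))))
                   (dec-true em refl)

    g-d : ∀ i a → g i (pair a (d i)) ≡ v i a
    g-d i a = cong (λ t → f i (a ∷ (if t then proj₁ (U i a) else proj₁ (V i a))))
                   (dec-false em λ d≡c → proj₂ (proj₂ (two i)) (sym d≡c))

    g-poly : IsPolymorphism P Q g
    -- The section at the first tuple is of box type, so tails may be chosen independently in each
    -- coordinate.
    g-poly x x∈P = box (x∈P zero) λ i → G i (λ s → x s i) , refl

    conclude : BoxTrivialOperations Q Φ g → DictatorType Φ f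
    conclude (inj₁ (zero , φ , φ∈Φ , g≡φ)) = zero , φ , φ∈Φ , λ i x →
      let a   = head x
          u≡φ = trans (sym (g-c i a)) (g≡φ i (pair a (c i)))
          v≡φ = trans (sym (g-d i a)) (g≡φ i (pair a (d i)))
      in trans (sym (∷-η (f i) x))
           (trans (proj₂ (V i a) (trans v≡φ (sym u≡φ)) (tail x)) u≡φ)
    -- Here `u i` is constant, so `b i` is also a value of the section at `p`, whose box lies in
    -- `Q`.
    conclude (inj₁ (suc zero , φ , φ∈Φ , g≡φ)) = contradiction b∈Q b∉Q
      where
      u-constant : ∀ i a → u i a ≡ φ i (c i)
      u-constant i a = trans (sym (g-c i a)) (g≡φ i (pair a (c i)))

      b∈Q : b ∈ Q
      b∈Q = box p∈P λ i → proj₁ (U i (p i)) ,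
        trans (u-constant i (p i)) (trans (sym (u-constant i (a₀ i))) (u-a₀ i))
    conclude (inj₂ g-box) =
      contradiction (g-box λ i → pair (a₀ i) (c i) , trans (g-c i (a₀ i)) (u-a₀ i)) b∉Q

  boxSections⇒boxTrivial :
    BoxTrivial P Q Φ 2 → (∀ i → AtLeastTwo (Σ i)) → ∀ {p} → p ∈ P →
    (f : Operations (suc n) Σ Δ) → (∀ {q} → q ∈ P → BoxType Q (section f q)) →
    BoxTrivialOperations Q Φ f
  boxSections⇒boxTrivial triv₂ two p∈P f box with em {DictatorType Φ f}
  ... | yes dict = inj₁ dict
  ... | no ¬dict = inj₂ λ b∈ → decidable-stable em λ b∉Q →
          ¬dict (boxSections⇒dictator triv₂ two p∈P f box b∈ b∉Q)

  -- Since `φ` is not a box map, an operation whose images contain those of `φ` is not of box type,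
  -- and `φ` cannot be constant in every coordinate. These two facts rule out all unwanted cases
  -- below.
  dictatorSection⇒dictator :
    BoxTrivial P Q Φ 2 → BoxTrivial P Q Φ n → FullProjections P →
    (f : Operations (suc n) Σ Δ) → IsPolymorphism P Q f →
    ∀ {p t φ} → p ∈ P → φ ∈ Φ → (∀ i x → section f p i x ≡ φ i (x t)) →
    ¬ BoxMap φ → DictatorType Φ f
  dictatorSection⇒dictator {n = n} triv₂ trivₙ full f f-poly {p} {t} {φ} p∈P φ∈Φ fp≡φ ¬box =
    suc t , φ , φ∈Φ , λ i x →
      -- The tuple `q` depends on `i`: the heads of the arguments in the different coordinates need
      -- not form a tuple of `P`.
      let q , q∈P , qᵢ≡x₀ = full i (head x) in
      trans (sym (∷-η (f i) x))
        (trans (cong (λ a → f i (a ∷ tail x)) (sym qᵢ≡x₀)) (sections q∈P i (tail x)))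
    where
    φp∈Q : (λ i → φ i (p i)) ∈ Q
    φp∈Q = Q-respects (λ i → fp≡φ i (const (p i)))
            (section-isPolymorphism f f-poly p∈P (const p) (const p∈P))

    headMinor : ∀ i a y → minor headMerge f i (pair a y) ≡ f i (a ∷ const y)
    headMinor i a y = cong (f i) (ext λ { zero → refl ; (suc _) → refl })

    headMinor-p : ∀ i a → minor headMerge f i (pair (p i) a) ≡ φ i a
    headMinor-p i a = trans (headMinor i (p i) a) (fp≡φ i (const a))

    -- The minor sending `(a , y)` to `f i (a ∷ const y)` is `φ i y` at `a = p i`. It must be a
    -- dictator in `y`, hence has the same value for every `a`.
    diagonal : ∀ i a y → f i (a ∷ const y) ≡ φ i y
    diagonal i a y with triv₂ (minor headMerge f) (minor-isPolymorphism headMerge f f-poly)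
    ... | inj₁ (zero , ψ , _ , f≡ψ) = ⊥-elim (¬box
            (constant⇒boxMap φp∈Q λ i a →
              trans (sym (headMinor-p i a))
                (trans (f≡ψ i (pair (p i) a)) (trans (sym (f≡ψ i (pair (p i) (p i))))
                  (headMinor-p i (p i))))))
    ... | inj₁ (suc zero , ψ , _ , f≡ψ) =
            trans (sym (headMinor i a y))
              (trans (f≡ψ i (pair a y)) (trans (sym (f≡ψ i (pair (p i) y))) (headMinor-p i y)))
    ... | inj₂ box = ⊥-elim (¬box
            (Im⊆⇒boxMap (λ i a → pair (p i) a , headMinor-p i a) box))

    π : Fin (suc n) → Fin 2
    π = singletonMerge (suc t)

    tMinor-p : ∀ i a → minor π f i (pair a (p i)) ≡ φ i a
    tMinor-p i a = trans (sym (∷-η (f i) (pair a (p i) ∘ π)))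
      (trans (fp≡φ i (tail (pair a (p i) ∘ π)))
        (cong (φ i ∘ pair a (p i)) (singletonMerge-≡ (suc t))))

    -- If `t′` differs from `t`, the minor by `π` is `φ i a` at `(a , p i)` but `φ′ i (q i)`, free
    -- of `a`, at `(a , q i)`. A dictator in either argument would then force `φ` to be constant.
    samePosition : ∀ {q t′ φ′} → (∀ i x → section f q i x ≡ φ′ i (x t′)) →
                   (∀ i a → φ i a ≡ φ′ i a) → t′ ≡ t
    samePosition {q} {t′} {φ′} fq≡φ′ φ≡φ′ with t′ ≟ᶠ t
    ... | yes t′≡t = t′≡t
    ... | no t′≢t
      with triv₂ (minor π f) (minor-isPolymorphism π f f-poly)
    ...   | inj₁ (zero , χ , _ , f≡χ) = ⊥-elim (¬box
              (constant⇒boxMap φp∈Q λ i a →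
                trans (constant i a) (sym (constant i (p i)))))
      where
      constant : ∀ i a → φ i a ≡ φ′ i (q i)
      constant i a =
        trans (sym (tMinor-p i a)) (trans (f≡χ i (pair a (p i))) (trans (sym (f≡χ i (pair a (q i))))
          (trans (sym (∷-η (f i) (pair a (q i) ∘ π))) (trans (fq≡φ′ i (tail (pair a (q i) ∘ π)))
            (cong (φ′ i ∘ pair a (q i)) (singletonMerge-≢ (t′≢t ∘ suc-injective)))))))
    ...   | inj₁ (suc zero , χ , _ , f≡χ) = ⊥-elim (¬box
              (constant⇒boxMap φp∈Q λ i a →
                trans (sym (tMinor-p i a))
                  (trans (f≡χ i (pair a (p i)))
                    (trans (sym (f≡χ i (pair (p i) (p i)))) (tMinor-p i (p i))))))
    ...   | inj₂ box = ⊥-elim (¬box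
              (Im⊆⇒boxMap (λ i a → pair a (p i) , tMinor-p i a) box))

    sections : ∀ {q} → q ∈ P → ∀ i x → f i (q i ∷ x) ≡ φ i (x t)
    sections {q} q∈P i x with trivₙ (section f q) (section-isPolymorphism f f-poly q∈P)
    ... | inj₁ (t′ , φ′ , _ , fq≡φ′) =
            trans (fq≡φ′ i x) (trans (sym (φ≡φ′ i (x t′)))
              (cong (φ i ∘ x) (samePosition {q} {t′} {φ′} fq≡φ′ φ≡φ′)))
      where
      φ≡φ′ : ∀ i a → φ i a ≡ φ′ i a
      -- On a constant tail the position `t′` does not matter, so `diagonal` identifies the two maps
      -- before the positions are compared.
      φ≡φ′ i a = trans (sym (diagonal i (q i) a)) (fq≡φ′ i (const a))
    ... | inj₂ box = ⊥-elim (¬box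
            (Im⊆⇒boxMap (λ i a → const a , diagonal i (q i) a) box))

  boxTrivial-suc : BoxTrivial P Q Φ 2 → (∀ i → AtLeastTwo (Σ i)) → FullProjections P →
                   ∃[ p ] p ∈ P → BoxTrivial P Q Φ n → BoxTrivial P Q Φ (suc n)
  boxTrivial-suc triv₂ two full (_ , p₀∈P) trivₙ f f-poly
    with em {∃[ p ] p ∈ P × ¬ BoxType Q (section f p)}
  ... | no ∄p = boxSections⇒boxTrivial triv₂ two p₀∈P f λ {q} q∈P →
          decidable-stable (em {BoxType Q (section f q)}) λ ¬box → ∄p (q , q∈P , ¬box)
  ... | yes (p , p∈P , ¬box) with trivₙ (section f p) (section-isPolymorphism f f-poly p∈P)
  ...   | inj₁ (t , φ , φ∈Φ , fp≡φ) = inj₁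
            (dictatorSection⇒dictator triv₂ trivₙ full f f-poly p∈P φ∈Φ fp≡φ
              -- Were `φ` a box map, the section at `p` would be of box type.
              (¬box ∘ dictator-boxType fp≡φ))
  ...   | inj₂ box = ⊥-elim (¬box box)

theorem1p3 : {ℓ : Level} → ExcludedMiddle ℓ → Extensionality 0ℓ ℓ →
    (m : ℕ) → m ≥ 1 →
    (Σ Δ : Family m ℓ) →
    (P : Relation Σ) (Q : Relation Δ) (Φ : Pred (Maps Σ Δ) ℓ) →
    (∀ i → AtLeastTwo (Σ i)) →
    FullProjections P →
    ((∀ n → n ≥ 1 → BoxTrivial P Q Φ n) ⇔ BoxTrivial P Q Φ 2)
theorem1p3 em ext m m≥1 Σ Δ P Q Φ two full =
  mk⇔ (λ triv → triv 2 (s≤s z≤n)) λ { triv₂ (suc n) _ → induct triv₂ n }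
  where
  P-inhabited : ∃[ p ] p ∈ P
  P-inhabited =
    let i = fromℕ< m≥1
        p , p∈P , _ = full i (proj₁ (two i))
    in p , p∈P

  induct : BoxTrivial P Q Φ 2 → ∀ n → BoxTrivial P Q Φ (suc n)
  induct triv₂ zero    = boxTrivial₂⇒₁ em ext {P = P} {Q = Q} {Φ = Φ} triv₂
  induct triv₂ (suc n) = boxTrivial-suc em ext triv₂ two full P-inhabited (induct triv₂ n)
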